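{- For a (finite simple) graph $G$, the following are equivalent: (1) $G$ is threshold; (2) the clique hypergraph ${\cal C}(G)$ is $1$-Sperner; (3) ${\cal C}(G)$ is threshold; (4) ${\cal C}(G)$ is $2$-asummable.
   Context: A hypergraph ${\cal H}=(V,{\cal E})$ consists of a finite vertex set $V$ and a set ${\cal E}$ of subsets of $V$. A set $X\subseteq V$ is dependent if it contains some hyperedge, and independent otherwise. ${\cal H}$ is threshold if there exist $w:V\to\mathbb{Z}_{\ge0}$ and $t\in\mathbb{Z}_{\ge0}$ such that for every $X\subseteq V$, $\sum_{x\in X}w(x)\ge t$ iff $X$ is dependent. A graph is threshold if, viewed as the hypergraph $(V(G),E(G))$ whose hyperedges are its edges, it is threshold. ${\cal H}$ is $1$-Sperner if every two distinct hyperedges $e,f$ satisfy $\min\{|e\setminus f|,|f\setminus e|\}=1$. ${\cal H}$ is $2$-asummable if there are no independent sets $A_1,A_2$ and dependent sets $B_1,B_2$ (not necessarily distinct) with $\chi^{A_1}+\chi^{A_2}=\chi^{B_1}+\chi^{B_2}$, where $\chi^S\in\{0,1\}^V$ is the characteristic vector of $S$. The clique hypergraph ${\cal C}(G)$ has vertex set $V(G)$ and hyperedges the maximal cliques of $G$. -}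

module Defs where

open import Data.Bool.Base using (if_then_else_)
import Data.Bool.Properties as Bool
open import Data.Fin.Base using (Fin)
open import Data.Fin.Properties using (all?; any?; _≟_)
open import Data.Fin.Subset
  using (Subset; _∈_; _⊆_; _⊂_; _─_; _∪_; ⁅_⁆; ∣_∣)
open import Data.Fin.Subset.Properties using (_∈?_; _⊂?_; anySubset?)
open import Data.Nat.Base using (ℕ; _+_; _⊓_; _≥_)
open import Data.Nat.Properties using (+-0-commutativeMonoid)
open import Data.Product.Base using (Σ-syntax; ∃-syntax; _×_)
open import Data.Vec.Base using (lookup)
open import Data.Vec.Properties using (≡-dec)
open import Function.Bundles using (_⇔_)
open import Level using (0ℓ)
open import Relation.Binary.Core using (Rel)
open import Relation.Binary.Definitions
  using (Symmetric; Irreflexive) renaming (Decidable to Decidable₂)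
open import Relation.Binary.PropositionalEquality.Core using (_≡_; _≢_)
open import Relation.Nullary.Decidable using (_×-dec_; _→-dec_; ¬?)
open import Relation.Nullary.Negation.Core using (¬_)
open import Relation.Unary using (Pred; Decidable)

open import Algebra.Properties.CommutativeMonoid.Sum +-0-commutativeMonoid
  using (sum)

-- Being a hyperedge is decidable because a set of subsets of a finite set is
-- a finite set.

record Hypergraph (n : ℕ) : Set₁ where
  field
    Hyperedge  : Pred (Subset n) 0ℓ
    hyperedge? : Decidable Hyperedge

χ : ∀ {n} → Subset n → Fin n → ℕ
χ S x = if lookup S x then 1 else 0

weight : ∀ {n} → (Fin n → ℕ) → Subset n → ℕ
weight w X = sum (λ x → if lookup X x then w x else 0)

module _ {n : ℕ} (H : Hypergraph n) where
  open Hypergraph H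

  Dependent : Pred (Subset n) 0ℓ
  Dependent X = ∃[ e ] Hyperedge e × e ⊆ X

  Independent : Pred (Subset n) 0ℓ
  Independent X = ¬ Dependent X

  Threshold : Set
  Threshold = Σ[ w ∈ (Fin n → ℕ) ] Σ[ t ∈ ℕ ]
    (∀ (X : Subset n) → weight w X ≥ t ⇔ Dependent X)

  1-Sperner : Set
  1-Sperner = ∀ (e f : Subset n) → Hyperedge e → Hyperedge f → e ≢ f →
    ∣ e ─ f ∣ ⊓ ∣ f ─ e ∣ ≡ 1

  2-Asummable : Set
  2-Asummable = ¬ (∃[ A₁ ] ∃[ A₂ ] ∃[ B₁ ] ∃[ B₂ ]
    Independent A₁ × Independent A₂ × Dependent B₁ × Dependent B₂ ×
    (∀ (x : Fin n) → χ A₁ x + χ A₂ x ≡ χ B₁ x + χ B₂ x))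

record Graph (n : ℕ) : Set₁ where
  field
    Adjacent  : Rel (Fin n) 0ℓ
    adjacent? : Decidable₂ Adjacent
    symmetric : Symmetric Adjacent
    loopless  : Irreflexive _≡_ Adjacent

module _ {n : ℕ} (G : Graph n) where
  open Graph G

  edgeHypergraph : Hypergraph n
  edgeHypergraph = record
    { Hyperedge  = λ e → ∃[ u ] ∃[ v ] Adjacent u v × e ≡ ⁅ u ⁆ ∪ ⁅ v ⁆
    ; hyperedge? = λ e → any? λ u → any? λ v →
        adjacent? u v ×-dec ≡-dec Bool._≟_ e (⁅ u ⁆ ∪ ⁅ v ⁆)
    }

  Clique : Pred (Subset n) 0ℓ
  Clique S = ∀ (u v : Fin n) → u ∈ S → v ∈ S → u ≢ v → Adjacent u v

  clique? : Decidable Clique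
  clique? S = all? λ u → all? λ v →
    (u ∈? S) →-dec (v ∈? S) →-dec ¬? (u ≟ v) →-dec adjacent? u v

  MaximalClique : Pred (Subset n) 0ℓ
  MaximalClique S = Clique S × ¬ (∃[ T ] Clique T × S ⊂ T)

  maximalClique? : Decidable MaximalClique
  maximalClique? S =
    clique? S ×-dec ¬? (anySubset? λ T → clique? T ×-dec (S ⊂? T))

  cliqueHypergraph : Hypergraph n
  cliqueHypergraph = record
    { Hyperedge  = MaximalClique
    ; hyperedge? = maximalClique?
    }

  ThresholdGraph : Set
  ThresholdGraph = Threshold edgeHypergraph

{-# OPTIONS --safe #-}
module Submission where

-- All four conditions are equivalent to the absence of an alternating 4-cycle:
-- vertices a, b, c, d with edges ab, cd and non-edges ac, bd.
--
-- An alternating 4-cycle contradicts 2-asummability of the edge hypergraph,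
-- because {a,c} + {b,d} = {a,b} + {c,d}, and 1-Spernerness of the clique
-- hypergraph, because maximal cliques K ∋ a, b and L ∋ c, d satisfy
-- a, b ∉ L and c, d ∉ K.  For 2-asummability of the clique hypergraph, exchange
-- b ∈ K for c ∈ L; the resulting sets are independent if b is adjacent to c, and
-- also otherwise, once the alternating 4-cycles with an edge bc are excluded.
--
-- Conversely, without alternating 4-cycles every nonempty set of vertices
-- contains a vertex that is isolated or dominating in it, and threshold weights
-- for both hypergraphs are obtained by deleting such vertices one at a time.
-- The 1-Sperner property holds because the non-edges between K \ L and L \ K
-- meet every vertex of these sets but contain no two disjoint pairs.

open import Defs

open import Algebra.Properties.CommutativeSemigroup using (x∙yz≈y∙xz)
open import Data.Bool.Base using (true; false; if_then_else_)
open import Data.Bool.Properties using (if-float)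
open import Data.Empty using (⊥)
open import Data.Fin.Base using (Fin; zero; suc)
open import Data.Fin.Properties using (any?; all?; _≟_)
open import Data.Fin.Subset
  using (Subset; inside; outside; _∈_; _∉_; _⊆_; _⊂_; _⊃_; _∪_; _─_; _-_; ⁅_⁆; ∣_∣;
         ⊤; Nonempty; Empty)
open import Data.Fin.Subset.Induction using (Acc; acc; ⊂-wellFounded; ⊃-wellFounded)
open import Data.Fin.Subset.Properties
  using (_∈?_; _⊂?_; anySubset?; nonempty?; ∈⊤; ⊆-antisym; ⊆-refl; x∈⁅x⁆; x∈⁅y⁆⇒x≡y; ∣⁅x⁆∣≡1;
         p⊆p∪q; q⊆p∪q; x∈p∪q⁺; x∈p∪q⁻; p─q⊆p; p─⊥≡p; x∈p∧x∉q⇒x∈p─q;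
         x∈p∧x≢y⇒x∈p-y; x∈p⇒p-x⊂p; x∈p⇒∣p-x∣<∣p∣; p⊆q⇒∣p∣≤∣q∣; ⊆⊤; drop-∷-⊆)
open import Data.Nat.Base using (ℕ; suc; _+_; _*_; _≤_; _<_; z≤n; s≤s)
open import Data.Nat.Properties
  using (≤-refl; ≤-trans; ≤-reflexive; ≤-antisym; <-irrefl; <-≤-trans; ≤-<-trans; ≰⇒>; _≤?_; n≤1+n;
         m≤m+n; m≤n+m; +-mono-≤; +-mono-<; +-monoʳ-≤; +-monoʳ-<; +-cancelˡ-≤; +-identityʳ;
         +-comm; *-distribʳ-+; ⊓-glb; m≤n⊓o⇒m≤n; m≤n⊓o⇒m≤o; +-0-commutativeMonoid;
         +-commutativeSemigroup; module ≤-Reasoning)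
open import Data.Product.Base using (Σ-syntax; ∃-syntax; _×_; _,_; proj₁; proj₂)
open import Data.Sum.Base using (_⊎_; inj₁; inj₂; [_,_])
open import Data.Vec.Base using (_∷_; []; here; there; lookup; tabulate)
open import Data.Vec.Functional using (updateAt)
open import Data.Vec.Functional.Properties using (updateAt-updates; updateAt-minimal)
open import Data.Vec.Properties using ([]=⇒lookup; lookup⇒[]=; lookup∘tabulate)
open import Function.Base using (_∘_; const)
open import Function.Bundles using (_⇔_; mk⇔; Equivalence)
open import Function.Construct.Composition using (_⇔-∘_)
open import Relation.Binary.PropositionalEquality
  using (_≡_; _≢_; refl; sym; trans; cong; cong₂; subst; ≢-sym; module ≡-Reasoning)
open import Relation.Nullary using (¬_; yes; no; does; contradiction)
open import Relation.Nullary.Decidable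
  using (_×-dec_; _⊎-dec_; _→-dec_; ¬?; decidable-stable; dec-true; dec-false)
open import Relation.Unary using (Pred; Decidable)

open import Algebra.Properties.CommutativeMonoid.Sum +-0-commutativeMonoid
  using (sum; ∑-distrib-+; sum-cong-≗)

open Equivalence using (to; from)

-- Arithmetic and finite subsets

private
  variable
    n : ℕ
    p q : Subset n
    x y : Fin n

-- An even number that is at most `2t + 1` is at most `2t`. The slack of one is the weight of an
-- isolated vertex after doubling.
halve : ∀ {s t} → s + s ≤ suc (t + t) → s ≤ t
halve {s} {t} 2s≤1+2t = decidable-stable (s ≤? t) λ s≰t → <-irrefl refl (begin-strict
  s + s         ≤⟨ 2s≤1+2t ⟩
  suc t + t     <⟨ +-monoʳ-< (suc t) ≤-refl ⟩
  suc t + suc t ≤⟨ +-mono-≤ (≰⇒> s≰t) (≰⇒> s≰t) ⟩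
  s + s         ∎)
  where open ≤-Reasoning

x∈p─q⇒x∉q : ∀ (p q : Subset n) → x ∈ p ─ q → x ∉ q
x∈p─q⇒x∉q (_ ∷ p) (inside  ∷ q) (there x∈p─q) (there x∈q) = x∈p─q⇒x∉q p q x∈p─q x∈q
x∈p─q⇒x∉q (_ ∷ p) (outside ∷ q) (there x∈p─q) (there x∈q) = x∈p─q⇒x∉q p q x∈p─q x∈q

x∈p-y⇒x≢y : ∀ (p : Subset n) → x ∈ p - y → x ≢ y
x∈p-y⇒x≢y {x = x} p x∈p-y refl = x∈p─q⇒x∉q p ⁅ x ⁆ x∈p-y (x∈⁅x⁆ x)

x∉p-x : ∀ (p : Subset n) → x ∉ p - x
x∉p-x p x∈p-x = x∈p-y⇒x≢y p x∈p-x refl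

p⊆q∧x∉p⇒p⊆q-x : p ⊆ q → x ∉ p → p ⊆ q - x
p⊆q∧x∉p⇒p⊆q-x p⊆q x∉p y∈p = x∈p∧x≢y⇒x∈p-y (p⊆q y∈p) λ { refl → x∉p y∈p }

p⊆q⇒p-x⊆q-x : p ⊆ q → p - x ⊆ q - x
p⊆q⇒p-x⊆q-x {p = p} {x = x} p⊆q y∈ =
  x∈p∧x≢y⇒x∈p-y (p⊆q (p─q⊆p p ⁅ x ⁆ y∈)) (x∈p-y⇒x≢y p y∈)

Empty-─⇒⊆ : ∀ (p q : Subset n) → Empty (p ─ q) → p ⊆ q
Empty-─⇒⊆ p q empty {x} x∈p =
  decidable-stable (x ∈? q) λ x∉q → empty (x , x∈p∧x∉q⇒x∈p─q x∈p x∉q)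

Nonempty⇒0<∣p∣ : Nonempty p → 0 < ∣ p ∣
Nonempty⇒0<∣p∣ (x , x∈p) = ≤-<-trans z≤n (x∈p⇒∣p-x∣<∣p∣ x∈p)

distinct⇒1<∣p∣ : x ∈ p → y ∈ p → x ≢ y → 1 < ∣ p ∣
distinct⇒1<∣p∣ x∈p y∈p x≢y =
  ≤-<-trans (Nonempty⇒0<∣p∣ (_ , x∈p∧x≢y⇒x∈p-y x∈p x≢y)) (x∈p⇒∣p-x∣<∣p∣ y∈p)

1<∣p∣⇒another : ∀ (p : Subset n) x → 1 < ∣ p ∣ → ∃[ y ] y ∈ p × y ≢ x
1<∣p∣⇒another p x 1<∣p∣ with nonempty? (p - x)
... | yes (y , y∈) = y , p─q⊆p p ⁅ x ⁆ y∈ , x∈p-y⇒x≢y p y∈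
... | no empty = contradiction
  (<-≤-trans 1<∣p∣ (≤-trans (p⊆q⇒∣p∣≤∣q∣ (Empty-─⇒⊆ p ⁅ x ⁆ empty)) (≤-reflexive (∣⁅x⁆∣≡1 x))))
  (<-irrefl refl)

module _ {P : Fin n → Set} (P? : Decidable P) where

  comprehension : Subset n
  comprehension = tabulate (does ∘ P?)

  ∈-comprehension⁺ : P x → x ∈ comprehension
  ∈-comprehension⁺ {x} px =
    lookup⇒[]= x _ (trans (lookup∘tabulate _ x) (dec-true (P? x) px))

  ∈-comprehension⁻ : x ∈ comprehension → P x
  ∈-comprehension⁻ {x} x∈ = decidable-stable (P? x) λ ¬px →
    contradiction
      (trans (sym (trans (sym (lookup∘tabulate _ x)) ([]=⇒lookup x∈))) (dec-false (P? x) ¬px))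
      λ ()

-- Weights of sets and their updates

weight-cong : ∀ {w w′ : Fin n → ℕ} X → (∀ {x} → x ∈ X → w x ≡ w′ x) → weight w X ≡ weight w′ X
weight-cong []            eq = refl
weight-cong (outside ∷ X) eq = weight-cong X (eq ∘ there)
weight-cong (inside  ∷ X) eq = cong₂ _+_ (eq here) (weight-cong X (eq ∘ there))

weight-mono-⊆ : ∀ (w : Fin n → ℕ) X Y → X ⊆ Y → weight w X ≤ weight w Y
weight-mono-⊆ w []            []            X⊆Y = z≤n
weight-mono-⊆ w (outside ∷ X) (outside ∷ Y) X⊆Y = weight-mono-⊆ _ X Y (drop-∷-⊆ X⊆Y)
weight-mono-⊆ w (outside ∷ X) (inside  ∷ Y) X⊆Y =
  ≤-trans (weight-mono-⊆ _ X Y (drop-∷-⊆ X⊆Y)) (m≤n+m _ _)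
weight-mono-⊆ w (inside  ∷ X) (outside ∷ Y) X⊆Y with X⊆Y here
... | ()
weight-mono-⊆ w (inside  ∷ X) (inside  ∷ Y) X⊆Y = +-monoʳ-≤ _ (weight-mono-⊆ _ X Y (drop-∷-⊆ X⊆Y))

weight-remove : ∀ (w : Fin n → ℕ) X → x ∈ X → weight w X ≡ w x + weight w (X - x)
weight-remove w (inside ∷ X) here = cong (λ Y → w zero + weight (w ∘ suc) Y) (sym (p─⊥≡p X))
weight-remove w (outside ∷ X) (there x∈X) = weight-remove (w ∘ suc) X x∈X
weight-remove {x = suc x} w (inside ∷ X) (there x∈X) = begin
  w zero + weight (w ∘ suc) X                         ≡⟨ cong (w zero +_) (weight-remove (w ∘ suc) X x∈X) ⟩
  w zero + (w (suc x) + weight (w ∘ suc) (X - x))     ≡⟨ x∙yz≈y∙xz +-commutativeSemigroup (w zero) (w (suc x)) _ ⟩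
  w (suc x) + (w zero + weight (w ∘ suc) (X - x))     ∎
  where open ≡-Reasoning

weight-∈-≤ : ∀ (w : Fin n → ℕ) X → x ∈ X → w x ≤ weight w X
weight-∈-≤ w X x∈X = ≤-trans (m≤m+n _ _) (≤-reflexive (sym (weight-remove w X x∈X)))

0<weight⇒Nonempty : ∀ (w : Fin n → ℕ) X → 0 < weight w X → Nonempty X
0<weight⇒Nonempty w (inside  ∷ X) 0<w = zero , here
0<weight⇒Nonempty w (outside ∷ X) 0<w with 0<weight⇒Nonempty (w ∘ suc) X 0<w
... | x , x∈X = suc x , there x∈X

weight-double : ∀ (w : Fin n → ℕ) X → weight (λ x → w x + w x) X ≡ weight w X + weight w X
weight-double w X = trans
  (sum-cong-≗ λ x → sym (if-float (λ m → m + m) (lookup X x)))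
  (∑-distrib-+ (λ x → if lookup X x then w x else 0) _)

-- Through this, two pairs of sets with equal sums of characteristic vectors have equal total
-- weight.
weight-sum : ∀ (w : Fin n → ℕ) X Y → weight w X + weight w Y ≡ sum (λ x → (χ X x + χ Y x) * w x)
weight-sum w X Y = trans (sym (∑-distrib-+ (λ x → if lookup X x then w x else 0) _)) (sum-cong-≗ pointwise)
  where
  scale : ∀ b m → (if b then m else 0) ≡ (if b then 1 else 0) * m
  scale true  m = sym (+-identityʳ m)
  scale false m = refl

  pointwise : ∀ x → (if lookup X x then w x else 0) + (if lookup Y x then w x else 0)
                    ≡ (χ X x + χ Y x) * w x
  pointwise x = trans (cong₂ _+_ (scale (lookup X x) (w x)) (scale (lookup Y x) (w x)))
                      (sym (*-distribʳ-+ (w x) (χ X x) (χ Y x)))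

infixl 6 _[_≔_]

_[_≔_] : (Fin n → ℕ) → Fin n → ℕ → Fin n → ℕ
w [ v ≔ k ] = updateAt w v (const k)

weight-update-∉ : ∀ (w : Fin n → ℕ) v k X → v ∉ X → weight (w [ v ≔ k ]) X ≡ weight w X
weight-update-∉ w v k X v∉X =
  weight-cong X λ {x} x∈X → updateAt-minimal x v w λ { refl → v∉X x∈X }

weight-update-∈ : ∀ (w : Fin n → ℕ) v k X → v ∈ X → weight (w [ v ≔ k ]) X ≡ k + weight w (X - v)
weight-update-∈ w v k X v∈X = trans (weight-remove (w [ v ≔ k ]) X v∈X)
  (cong₂ _+_ (updateAt-updates v w) (weight-update-∉ w v k (X - v) (x∉p-x X)))

update-positive : ∀ {w : Fin n → ℕ} {k} → (∀ {u} → u ∈ p - x → 0 < w u) → 0 < k →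
  ∀ {u} → u ∈ p → 0 < (w [ x ≔ k ]) u
update-positive {x = x} {w = w} 0<w 0<k {u} u∈p with u ≟ x
... | yes refl = subst (0 <_) (sym (updateAt-updates x w)) 0<k
... | no u≢x = subst (0 <_) (sym (updateAt-minimal u x w u≢x)) (0<w (x∈p∧x≢y⇒x∈p-y u∈p u≢x))

-- Characteristic vectors and exchanges

χ-∈ : ∀ {S : Subset n} → x ∈ S → χ S x ≡ 1
χ-∈ x∈S = cong (if_then 1 else 0) ([]=⇒lookup x∈S)

χ-∉ : ∀ {S : Subset n} → x ∉ S → χ S x ≡ 0
χ-∉ {x = x} {S} x∉S with lookup S x in eq
... | true  = contradiction (lookup⇒[]= x S eq) x∉S
... | false = refl

χ-cong : ∀ {S T : Subset n} → (x ∈ S → x ∈ T) → (x ∈ T → x ∈ S) → χ S x ≡ χ T x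
χ-cong {x = x} {S} {T} S→T T→S with x ∈? S
... | yes x∈S = trans (χ-∈ x∈S) (sym (χ-∈ (S→T x∈S)))
... | no  x∉S = trans (χ-∉ x∉S) (sym (χ-∉ (x∉S ∘ T→S)))

swap : Subset n → Fin n → Fin n → Subset n
swap K b c = (K - b) ∪ ⁅ c ⁆

∈-swap⁻ : ∀ (K : Subset n) b c → x ∈ swap K b c → (x ∈ K × x ≢ b) ⊎ x ≡ c
∈-swap⁻ K b c x∈ with x∈p∪q⁻ (K - b) ⁅ c ⁆ x∈
... | inj₁ x∈K-b = inj₁ (p─q⊆p K ⁅ b ⁆ x∈K-b , x∈p-y⇒x≢y K x∈K-b)
... | inj₂ x∈⁅c⁆ = inj₂ (x∈⁅y⁆⇒x≡y c x∈⁅c⁆)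

∈-swap⁺ : ∀ (K : Subset n) b c → (x ∈ K × x ≢ b) ⊎ x ≡ c → x ∈ swap K b c
∈-swap⁺ K b c (inj₁ (x∈K , x≢b)) = x∈p∪q⁺ (inj₁ (x∈p∧x≢y⇒x∈p-y x∈K x≢b))
∈-swap⁺ K b c (inj₂ refl)        = x∈p∪q⁺ {p = K - b} (inj₂ (x∈⁅x⁆ c))

removed∉swap : ∀ (K : Subset n) {b c} → b ≢ c → b ∉ swap K b c
removed∉swap K {b} {c} b≢c b∈ = [ (λ (_ , b≢b) → b≢b refl) , b≢c ] (∈-swap⁻ K b c b∈)

χ-swap : ∀ (K : Subset n) {b c} → x ≢ b → x ≢ c → χ (swap K b c) x ≡ χ K x
χ-swap K {b} {c} x≢b x≢c = χ-cong
  (λ x∈ → [ proj₁ , (λ x≡c → contradiction x≡c x≢c) ] (∈-swap⁻ K b c x∈))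
  (λ x∈K → ∈-swap⁺ K b c (inj₁ (x∈K , x≢b)))

-- The unit at `b` moves from `K` to the changed `L`, the unit at `c` moves the other way, and
-- nothing else is touched.
χ-exchange : ∀ (K L : Subset n) {b c} → b ∈ K → b ∉ L → c ∈ L → c ∉ K →
  ∀ x → χ (swap K b c) x + χ (swap L c b) x ≡ χ K x + χ L x
χ-exchange K L {b} {c} b∈K b∉L c∈L c∉K x with x ≟ b | x ≟ c
... | yes refl | _ = trans
  (cong₂ _+_ (χ-∉ (removed∉swap K λ { refl → b∉L c∈L })) (χ-∈ (∈-swap⁺ L c b (inj₂ refl))))
  (sym (cong₂ _+_ (χ-∈ b∈K) (χ-∉ b∉L)))
... | no _ | yes refl = trans
  (cong₂ _+_ (χ-∈ (∈-swap⁺ K b c (inj₂ refl))) (χ-∉ (removed∉swap L λ { refl → b∉L c∈L })))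
  (sym (cong₂ _+_ (χ-∉ c∉K) (χ-∈ c∈L)))
... | no x≢b | no x≢c = cong₂ _+_ (χ-swap K x≢b x≢c) (χ-swap L x≢c x≢b)

-- Threshold implies 2-asummable

module _ (H : Hypergraph n) where

  -- Two independent sets weigh less than `2t` together and two dependent sets at least `2t`, yet
  -- equal characteristic sums force equal totals.
  Threshold⇒2-Asummable : Threshold H → 2-Asummable H
  Threshold⇒2-Asummable (w , t , thr) (A₁ , A₂ , B₁ , B₂ , i₁ , i₂ , d₁ , d₂ , eq) =
    <-irrefl refl (begin-strict
      weight w A₁ + weight w A₂          <⟨ +-mono-< (light A₁ i₁) (light A₂ i₂) ⟩
      t + t                              ≤⟨ +-mono-≤ (from (thr B₁) d₁) (from (thr B₂) d₂) ⟩
      weight w B₁ + weight w B₂          ≡⟨ weight-sum w B₁ B₂ ⟩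
      sum (λ x → (χ B₁ x + χ B₂ x) * w x) ≡⟨ sum-cong-≗ (λ x → cong (_* w x) (eq x)) ⟨
      sum (λ x → (χ A₁ x + χ A₂ x) * w x) ≡⟨ weight-sum w A₁ A₂ ⟨
      weight w A₁ + weight w A₂          ∎)
    where
    open ≤-Reasoning

    light : ∀ A → Independent H A → weight w A < t
    light A ind = ≰⇒> (ind ∘ to (thr A))

  2-Asummable⇒¬exchange : 2-Asummable H → ∀ {K L b c} → Dependent H K → Dependent H L →
    b ∈ K → b ∉ L → c ∈ L → c ∉ K →
    Independent H (swap K b c) → Independent H (swap L c b) → ⊥
  2-Asummable⇒¬exchange asum {K} {L} dK dL b∈K b∉L c∈L c∉K iK iL =
    asum (_ , _ , K , L , iK , iL , dK , dL , χ-exchange K L b∈K b∉L c∈L c∉K)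

-- Alternating 4-cycles

module _ (G : Graph n) where
  open Graph G renaming (Adjacent to _~_; adjacent? to _~?_)

  private
    variable
      a b c d u v z : Fin n
      K L S X : Subset n

  -- The pairs `bc` and `ad` are left free, so the four vertices induce two disjoint edges, a path
  -- or a 4-cycle. Distinctness is demanded only of the non-edges; for all other pairs it follows
  -- from the adjacencies.
  Alternating : (a b c d : Fin n) → Set
  Alternating a b c d = a ~ b × c ~ d × a ≢ c × b ≢ d × ¬ a ~ c × ¬ b ~ d

  AlternatingFree : Set
  AlternatingFree = ∀ {a b c d} → ¬ Alternating a b c d

  ~⇒≢ : u ~ v → u ≢ v
  ~⇒≢ u~v u≡v = loopless u≡v u~v

  neighbour-of-one⇒≢ : u ~ z → ¬ v ~ z → u ≢ v
  neighbour-of-one⇒≢ u~z v≁z refl = v≁z u~z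

  ⟪_,_⟫ : Fin n → Fin n → Subset n
  ⟪ u , v ⟫ = ⁅ u ⁆ ∪ ⁅ v ⁆

  ∈-pair⁻ : x ∈ ⟪ u , v ⟫ → x ≡ u ⊎ x ≡ v
  ∈-pair⁻ {u = u} {v} x∈ with x∈p∪q⁻ ⁅ u ⁆ ⁅ v ⁆ x∈
  ... | inj₁ x∈u = inj₁ (x∈⁅y⁆⇒x≡y u x∈u)
  ... | inj₂ x∈v = inj₂ (x∈⁅y⁆⇒x≡y v x∈v)

  ∈-pairˡ : u ∈ ⟪ u , v ⟫
  ∈-pairˡ {u} = x∈p∪q⁺ (inj₁ (x∈⁅x⁆ u))

  ∈-pairʳ : v ∈ ⟪ u , v ⟫
  ∈-pairʳ {v} {u} = x∈p∪q⁺ {p = ⁅ u ⁆} (inj₂ (x∈⁅x⁆ v))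

  -- The edge hypergraph and alternating 4-cycles

  HasEdge : Pred (Subset n) _
  HasEdge X = ∃[ u ] ∃[ v ] u ∈ X × v ∈ X × u ~ v

  HasEdge⇔Dependent : HasEdge X ⇔ Dependent (edgeHypergraph G) X
  HasEdge⇔Dependent {X} = mk⇔
    (λ (u , v , u∈X , v∈X , u~v) → ⟪ u , v ⟫ , (u , v , u~v , refl) ,
      λ x∈ → [ (λ { refl → u∈X }) , (λ { refl → v∈X }) ] (∈-pair⁻ x∈))
    (λ { (_ , (u , v , u~v , refl) , e⊆X) → u , v , e⊆X ∈-pairˡ , e⊆X ∈-pairʳ , u~v })

  non-edge-independent : ¬ u ~ v → (∀ {x} → x ∈ X → x ≡ u ⊎ x ≡ v) →
    Independent (edgeHypergraph G) X
  non-edge-independent u≁v X⊆ dep with from HasEdge⇔Dependent dep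
  ... | y , z , y∈X , z∈X , y~z with X⊆ y∈X | X⊆ z∈X
  ... | inj₁ refl | inj₁ refl = loopless refl y~z
  ... | inj₁ refl | inj₂ refl = u≁v y~z
  ... | inj₂ refl | inj₁ refl = u≁v (symmetric y~z)
  ... | inj₂ refl | inj₂ refl = loopless refl y~z

  2-Asummable-edge⇒AlternatingFree : 2-Asummable (edgeHypergraph G) → AlternatingFree
  2-Asummable-edge⇒AlternatingFree asum {a} {b} {c} {d} (a~b , c~d , a≢c , b≢d , a≁c , b≁d) =
    -- Exchanging `b` for `c` turns the edges `ab`, `cd` into the non-edges `ac`, `bd`.
    2-Asummable⇒¬exchange (edgeHypergraph G) asum
      (to HasEdge⇔Dependent (a , b , ∈-pairˡ , ∈-pairʳ , a~b))
      (to HasEdge⇔Dependent (c , d , ∈-pairˡ , ∈-pairʳ , c~d))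
      ∈-pairʳ
      (λ b∈ → [ b≢c , b≢d ] (∈-pair⁻ b∈))
      ∈-pairˡ
      (λ c∈ → [ ≢-sym a≢c , ≢-sym b≢c ] (∈-pair⁻ c∈))
      (non-edge-independent a≁c λ x∈ →
        [ (λ (x∈ab , x≢b) → [ inj₁ , (λ x≡b → contradiction x≡b x≢b) ] (∈-pair⁻ x∈ab)) , inj₂ ]
        (∈-swap⁻ ⟪ a , b ⟫ b c x∈))
      (non-edge-independent b≁d λ x∈ →
        [ (λ (x∈cd , x≢c) → [ (λ x≡c → contradiction x≡c x≢c) , inj₂ ] (∈-pair⁻ x∈cd)) , inj₁ ]
        (∈-swap⁻ ⟪ c , d ⟫ c b x∈))
    where
    b≢c : b ≢ c
    b≢c = neighbour-of-one⇒≢ (symmetric a~b) (a≁c ∘ symmetric)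

  -- Maximal cliques

  -- Maximality is tested one vertex at a time and relative to `S`, which suits the later induction
  -- that deletes vertices from `S`.
  MaximalIn : Subset n → Pred (Subset n) _
  MaximalIn S K = ∀ {u} → u ∈ S → (∀ {k} → k ∈ K → k ≢ u → k ~ u) → u ∈ K

  clique-insert : Clique G K → (∀ {k} → k ∈ K → k ≢ u → k ~ u) → Clique G (K ∪ ⁅ u ⁆)
  clique-insert {K} {u} clique adj x y x∈ y∈ x≢y with x∈p∪q⁻ K ⁅ u ⁆ x∈ | x∈p∪q⁻ K ⁅ u ⁆ y∈
  ... | inj₁ x∈K | inj₁ y∈K = clique x y x∈K y∈K x≢y
  ... | inj₁ x∈K | inj₂ y∈u with refl ← x∈⁅y⁆⇒x≡y u y∈u = adj x∈K x≢y
  ... | inj₂ x∈u | inj₁ y∈K with refl ← x∈⁅y⁆⇒x≡y u x∈u = symmetric (adj y∈K (≢-sym x≢y))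
  ... | inj₂ x∈u | inj₂ y∈u =
    contradiction (trans (x∈⁅y⁆⇒x≡y u x∈u) (sym (x∈⁅y⁆⇒x≡y u y∈u))) x≢y

  MaximalClique⇒MaximalIn : MaximalClique G K → MaximalIn S K
  MaximalClique⇒MaximalIn {K} (clique , max) {u} _ adj = decidable-stable (u ∈? K) λ u∉K →
    max (K ∪ ⁅ u ⁆ , clique-insert clique adj , p⊆p∪q ⁅ u ⁆ , u , q⊆p∪q K ⁅ u ⁆ (x∈⁅x⁆ u) , u∉K)

  MaximalIn-⊤⇒MaximalClique : Clique G K → MaximalIn ⊤ K → MaximalClique G K
  MaximalIn-⊤⇒MaximalClique clique max = clique , λ (T , T-clique , K⊆T , u , u∈T , u∉K) →
    u∉K (max ∈⊤ λ k∈K k≢u → T-clique _ u (K⊆T k∈K) u∈T k≢u)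

  maximal-extension : Clique G K → ∃[ M ] MaximalClique G M × K ⊆ M
  maximal-extension {K} = extend K (⊃-wellFounded K)
    where
    extend : ∀ K → Acc _⊃_ K → Clique G K → ∃[ M ] MaximalClique G M × K ⊆ M
    extend K (acc rec) clique with anySubset? (λ T → clique? G T ×-dec (K ⊂? T))
    ... | no ¬larger = K , (clique , ¬larger) , ⊆-refl
    ... | yes (T , T-clique , K⊂T) with extend T (rec K⊂T) T-clique
    ...   | M , M-max , T⊆M = M , M-max , T⊆M ∘ proj₁ K⊂T

  pair-clique : u ~ v → Clique G ⟪ u , v ⟫
  pair-clique u~v x y x∈ y∈ x≢y with ∈-pair⁻ x∈ | ∈-pair⁻ y∈
  ... | inj₁ refl | inj₁ refl = contradiction refl x≢y
  ... | inj₁ refl | inj₂ refl = u~v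
  ... | inj₂ refl | inj₁ refl = symmetric u~v
  ... | inj₂ refl | inj₂ refl = contradiction refl x≢y

  edge-extension : u ~ v → ∃[ M ] MaximalClique G M × u ∈ M × v ∈ M
  edge-extension u~v with maximal-extension (pair-clique u~v)
  ... | M , M-max , uv⊆M = M , M-max , uv⊆M ∈-pairˡ , uv⊆M ∈-pairʳ

  -- From properties of the clique hypergraph to the absence of alternating 4-cycles

  clique-separates : Clique G K → u ∈ K → u ≢ v → ¬ u ~ v → v ∉ K
  clique-separates clique u∈K u≢v u≁v v∈K = u≁v (clique _ _ u∈K v∈K u≢v)

  1-Sperner⇒AlternatingFree : 1-Sperner (cliqueHypergraph G) → AlternatingFree
  1-Sperner⇒AlternatingFree sperner (a~b , c~d , a≢c , b≢d , a≁c , b≁d)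
    with edge-extension a~b | edge-extension c~d
  ... | K , K-max , a∈K , b∈K | L , L-max , c∈L , d∈L =
    -- `K ─ L` contains `a` and `b`, and `L ─ K` contains `c` and `d`, so the minimum exceeds 1.
    <-irrefl (sym (sperner K L K-max L-max λ { refl → c∉K c∈L })) (⊓-glb
      (distinct⇒1<∣p∣ (x∈p∧x∉q⇒x∈p─q a∈K a∉L) (x∈p∧x∉q⇒x∈p─q b∈K b∉L) (~⇒≢ a~b))
      (distinct⇒1<∣p∣ (x∈p∧x∉q⇒x∈p─q c∈L c∉K) (x∈p∧x∉q⇒x∈p─q d∈L d∉K) (~⇒≢ c~d)))
    where
    c∉K = clique-separates (proj₁ K-max) a∈K a≢c a≁c
    d∉K = clique-separates (proj₁ K-max) b∈K b≢d b≁d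
    a∉L = clique-separates (proj₁ L-max) c∈L (≢-sym a≢c) (a≁c ∘ symmetric)
    b∉L = clique-separates (proj₁ L-max) d∈L (≢-sym b≢d) (b≁d ∘ symmetric)

  -- A clique in the swapped set misses b, hence is not maximal if it also misses c,
  -- and can be extended by v if it contains c.
  swap-independent : Clique G K → b ∈ K → c ∉ K → c ~ v → v ∉ swap K b c →
    (∀ {k} → k ∈ K → k ≢ b → k ~ c → k ~ v) → Independent (cliqueHypergraph G) (swap K b c)
  swap-independent {K} {b} {c} {v} clique b∈K c∉K c~v v∉ adj (M , M-max , M⊆) with c ∈? M
  ... | yes c∈M = v∉ (M⊆ (MaximalClique⇒MaximalIn {S = ⊤} M-max ∈⊤ M~v))
    where
    M~v : ∀ {k} → k ∈ M → k ≢ v → k ~ v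
    M~v k∈M _ with ∈-swap⁻ K b c (M⊆ k∈M)
    ... | inj₂ refl = c~v
    ... | inj₁ (k∈K , k≢b) = adj k∈K k≢b (proj₁ M-max _ c k∈M c∈M λ { refl → c∉K k∈K })
  ... | no c∉M = proj₂ M-max (K , clique , proj₁ ∘ M⊆K-b , b , b∈K , λ b∈M → proj₂ (M⊆K-b b∈M) refl)
    where
    M⊆K-b : ∀ {x} → x ∈ M → x ∈ K × x ≢ b
    M⊆K-b x∈M with ∈-swap⁻ K b c (M⊆ x∈M)
    ... | inj₁ x∈ = x∈
    ... | inj₂ refl = contradiction x∈M c∉M

  alternating-reverse : Alternating a b c d → Alternating d c b a
  alternating-reverse (a~b , c~d , a≢c , b≢d , a≁c , b≁d) =
    symmetric c~d , symmetric a~b , ≢-sym b≢d , ≢-sym a≢c , b≁d ∘ symmetric , a≁c ∘ symmetric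

  -- Provides the vertex `v` for `swap-independent` before the clique `K` is chosen. The reversed
  -- quadruple `d c b a` gives the same condition for the other clique.
  Extendable : (a b c d : Fin n) → Set
  Extendable a b c d = ∃[ v ] c ~ v × (∀ {K} → Clique G K → a ∈ K → b ∈ K → d ∉ K →
    v ∉ swap K b c × (∀ {k} → k ∈ K → k ≢ b → k ~ c → k ~ v))

  -- Extend `ab` and `cd` to maximal cliques and exchange `b` for `c`: extendability on both sides
  -- makes both new sets independent.
  extendable-exchange : 2-Asummable (cliqueHypergraph G) → Alternating a b c d →
    Extendable a b c d → Extendable d c b a → ⊥
  extendable-exchange asum (a~b , c~d , a≢c , b≢d , a≁c , b≁d) (v , c~v , K-ext) (z , b~z , L-ext)
    with edge-extension a~b | edge-extension c~d
  ... | K , K-max , a∈K , b∈K | L , L-max , c∈L , d∈L =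
    2-Asummable⇒¬exchange (cliqueHypergraph G) asum
      (K , K-max , ⊆-refl) (L , L-max , ⊆-refl) b∈K b∉L c∈L c∉K
      (swap-independent (proj₁ K-max) b∈K c∉K c~v (proj₁ K-ext′) (proj₂ K-ext′))
      (swap-independent (proj₁ L-max) c∈L b∉L b~z (proj₁ L-ext′) (proj₂ L-ext′))
    where
    c∉K = clique-separates (proj₁ K-max) a∈K a≢c a≁c
    d∉K = clique-separates (proj₁ K-max) b∈K b≢d b≁d
    a∉L = clique-separates (proj₁ L-max) c∈L (≢-sym a≢c) (a≁c ∘ symmetric)
    b∉L = clique-separates (proj₁ L-max) d∈L (≢-sym b≢d) (b≁d ∘ symmetric)
    K-ext′ = K-ext (proj₁ K-max) a∈K b∈K d∉K
    L-ext′ = L-ext (proj₁ L-max) d∈L c∈L a∉L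

  -- The removed vertex `b` itself serves as `v`: the rest of `K` is adjacent to it because `K` is a
  -- clique.
  edge-extendable : b ~ c → Extendable a b c d
  edge-extendable {b} b~c = b , symmetric b~c , λ {K} clique _ b∈K _ →
    removed∉swap K (~⇒≢ b~c) , λ k∈K k≢b _ → clique _ b k∈K b∈K k≢b

  2-Asummable⇒no-middle-edge : 2-Asummable (cliqueHypergraph G) → Alternating a b c d → ¬ b ~ c
  2-Asummable⇒no-middle-edge asum alt b~c =
    extendable-exchange asum alt (edge-extendable b~c) (edge-extendable (symmetric b~c))

  -- If k ∈ K is adjacent to c but not to d, then b, k, c, d is alternating with middle edge kc.
  non-edge-extendable : 2-Asummable (cliqueHypergraph G) → Alternating a b c d → ¬ b ~ c →
    Extendable a b c d
  non-edge-extendable {a} {b} {c} {d} asum (a~b , c~d , a≢c , b≢d , a≁c , b≁d) b≁c =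
    d , c~d , λ {K} clique a∈K b∈K d∉K →
      (λ d∈ → [ d∉K ∘ proj₁ , ~⇒≢ (symmetric c~d) ] (∈-swap⁻ K b c d∈)) ,
      λ {k} k∈K k≢b k~c → decidable-stable (k ~? d) λ k≁d →
        2-Asummable⇒no-middle-edge asum
          (clique b k b∈K k∈K (≢-sym k≢b) , c~d , neighbour-of-one⇒≢ (symmetric a~b) (a≁c ∘ symmetric) ,
            (λ { refl → d∉K k∈K }) , b≁c , k≁d)
          k~c

  2-Asummable-clique⇒AlternatingFree : 2-Asummable (cliqueHypergraph G) → AlternatingFree
  2-Asummable-clique⇒AlternatingFree asum alt =
    extendable-exchange asum alt
      (non-edge-extendable asum alt b≁c)
      (non-edge-extendable asum (alternating-reverse alt) (b≁c ∘ symmetric))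
    where
    b≁c = 2-Asummable⇒no-middle-edge asum alt

  -- Alternating-free graphs have 1-Sperner clique hypergraphs

  non-neighbour : MaximalClique G K → u ∉ K → ∃[ v ] v ∈ K × ¬ u ~ v
  non-neighbour {K} {u} K-max u∉K with any? (λ v → v ∈? K ×-dec ¬? (u ~? v))
  ... | yes found = found
  ... | no ¬found = contradiction
    (MaximalClique⇒MaximalIn {S = ⊤} K-max ∈⊤ λ {k} k∈K _ →
      symmetric (decidable-stable (u ~? k) λ u≁k → ¬found (k , k∈K , u≁k)))
    u∉K

  non-neighbour-outside : Clique G L → MaximalClique G K → u ∈ L → u ∉ K →
    ∃[ v ] v ∈ K × v ∉ L × ¬ u ~ v
  non-neighbour-outside clique K-max u∈L u∉K with non-neighbour K-max u∉K
  ... | v , v∈K , u≁v = v , v∈K , clique-separates clique u∈L (λ { refl → u∉K v∈K }) u≁v , u≁v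

  maximal-difference : MaximalClique G K → Clique G L → K ≢ L → Nonempty (K ─ L)
  maximal-difference {K} {L} (_ , max) clique K≢L with nonempty? (K ─ L)
  ... | yes nonempty = nonempty
  ... | no empty = contradiction
    (⊆-antisym K⊆L λ {x} x∈L → decidable-stable (x ∈? K) λ x∉K → max (L , clique , K⊆L , x , x∈L , x∉K))
    K≢L
    where
    K⊆L = Empty-─⇒⊆ K L empty

  -- Neither of two distinct maximal cliques contains the other, so the minimum is at least 1; it
  -- remains to exclude that both differences have two vertices.
  AlternatingFree⇒1-Sperner : AlternatingFree → 1-Sperner (cliqueHypergraph G)
  AlternatingFree⇒1-Sperner free K L K-max L-max K≢L = ≤-antisym
    (decidable-stable (_ ≤? 1) λ ≰1 → ¬both-large
      (m≤n⊓o⇒m≤n _ ∣ L ─ K ∣ (≰⇒> ≰1)) (m≤n⊓o⇒m≤o ∣ K ─ L ∣ _ (≰⇒> ≰1)))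
    (⊓-glb (Nonempty⇒0<∣p∣ (maximal-difference K-max (proj₁ L-max) K≢L))
           (Nonempty⇒0<∣p∣ (maximal-difference L-max (proj₁ K-max) (≢-sym K≢L))))
    where
    ∈-─⁻ : ∀ p q → x ∈ p ─ q → x ∈ p × x ∉ q
    ∈-─⁻ p q x∈ = p─q⊆p p q x∈ , x∈p─q⇒x∉q p q x∈

    -- Disjoint non-edges `ac` and `bd` would form an alternating 4-cycle with the clique edges `ab`
    -- and `cd`.
    meet : ∀ {a b c d} → a ∈ K → b ∈ K → c ∈ L → d ∈ L → a ∉ L → b ∉ L →
      ¬ a ~ c → ¬ b ~ d → a ≢ b → c ≡ d
    meet {a} {b} {c} {d} a∈K b∈K c∈L d∈L a∉L b∉L a≁c b≁d a≢b = decidable-stable (c ≟ d) λ c≢d →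
      free (proj₁ K-max a b a∈K b∈K a≢b , proj₁ L-max c d c∈L d∈L c≢d ,
        (λ { refl → a∉L c∈L }) , (λ { refl → b∉L d∈L }) , a≁c , b≁d)

    ¬both-large : 1 < ∣ K ─ L ∣ → ¬ 1 < ∣ L ─ K ∣
    ¬both-large large₁ large₂
      with maximal-difference K-max (proj₁ L-max) K≢L
    ... | a , a∈ with 1<∣p∣⇒another (K ─ L) a large₁ | ∈-─⁻ K L a∈
    ... | b , b∈ , b≢a | a∈K , a∉L with ∈-─⁻ K L b∈
    ... | b∈K , b∉L
      with non-neighbour L-max a∉L | non-neighbour L-max b∉L
    ... | c , c∈L , a≁c | d , d∈L , b≁d
      -- So `a` and `b` share the non-neighbour `c`. For a second vertex `e` of `L ─ K`, a non-edge
      -- `ez` must meet both `ac` and `bc`, which forces `z` to equal `a` and `b` at once.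
      with refl ← meet a∈K b∈K c∈L d∈L a∉L b∉L a≁c b≁d (≢-sym b≢a)
      with 1<∣p∣⇒another (L ─ K) c large₂
    ... | e , e∈ , e≢c with ∈-─⁻ L K e∈
    ... | e∈L , e∉K with non-neighbour-outside (proj₁ L-max) K-max e∈L e∉K
    ... | z , z∈K , z∉L , e≁z = b≢a (trans (sym (z≡ b∈K b∉L b≁d)) (z≡ a∈K a∉L a≁c))
      where
      z≡ : ∀ {x} → x ∈ K → x ∉ L → ¬ x ~ c → z ≡ x
      z≡ {x} x∈K x∉L x≁c = decidable-stable (z ≟ x) λ z≢x →
        e≢c (meet z∈K x∈K e∈L c∈L z∉L x∉L (e≁z ∘ symmetric) x≁c z≢x)

  -- Dominating and isolated vertices

  Dominating Isolated : Subset n → Pred (Fin n) _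
  Dominating S v = ∀ {u} → u ∈ S → u ≢ v → v ~ u
  Isolated S v = ∀ {u} → u ∈ S → ¬ v ~ u

  closed? : ∀ x → Decidable (λ u → x ≡ u ⊎ x ~ u)
  closed? x u = (x ≟ u) ⊎-dec (x ~? u)

  N[_] : Fin n → Subset n
  N[ x ] = comprehension (closed? x)

  -- A neighbour `u` of `x` outside `N[ z ]` would give edges `xu`, `yz` and non-edges `xy`, `uz`.
  -- The vertex `y` makes the inclusion strict.
  N-⊂ : AlternatingFree → x ~ z → z ~ y → x ≢ y → ¬ x ~ y → N[ x ] ⊂ N[ z ]
  N-⊂ {x} {z} {y} free x~z z~y x≢y x≁y =
    (λ {u} u∈ → ∈-comprehension⁺ (closed? z) (included u (∈-comprehension⁻ (closed? x) u∈))) ,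
    y , ∈-comprehension⁺ (closed? z) (inj₂ z~y) , λ y∈ → [ x≢y , x≁y ] (∈-comprehension⁻ (closed? x) y∈)
    where
    included : ∀ u → x ≡ u ⊎ x ~ u → z ≡ u ⊎ z ~ u
    included u (inj₁ refl) = inj₂ (symmetric x~z)
    included u (inj₂ x~u) = decidable-stable (closed? z u) λ ¬zu →
      free (x~u , symmetric z~y , x≢y , ¬zu ∘ inj₁ ∘ sym , x≁y , ¬zu ∘ inj₂ ∘ symmetric)

  -- As long as x does not dominate S, some vertex of S has a larger closed neighbourhood.
  find-dominating : AlternatingFree → (∀ {v} → v ∈ S → ∃[ u ] u ∈ S × v ~ u) →
    Nonempty S → ∃[ v ] v ∈ S × Dominating S v
  find-dominating {S} free neighbour (x , x∈S) = search x x∈S (⊃-wellFounded N[ x ])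
    where
    search : ∀ x → x ∈ S → Acc _⊃_ N[ x ] → ∃[ v ] v ∈ S × Dominating S v
    search x x∈S (acc rec) with any? (λ y → y ∈? S ×-dec ¬? (x ≟ y) ×-dec ¬? (x ~? y))
    ... | no ¬found = x , x∈S , λ {u} u∈S u≢x →
      decidable-stable (x ~? u) λ x≁u → ¬found (u , u∈S , ≢-sym u≢x , x≁u)
    ... | yes (y , y∈S , x≢y , x≁y) with neighbour y∈S
    ...   | z , z∈S , y~z with x ~? z
    ...     | yes x~z = search z z∈S (rec (N-⊂ free x~z (symmetric y~z) x≢y x≁y))
    -- Move to a neighbour `u` of `x` instead: it must be adjacent to `z`, and then `N[ u ]` gains
    -- `z` over `N[ x ]`.
    ...     | no x≁z with neighbour x∈S
    ...       | u , u∈S , x~u = search u u∈S (rec (N-⊂ free x~u u~z x≢z x≁z))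
      where
      x≢z : x ≢ z
      x≢z refl = x≁y (symmetric y~z)

      u~z : u ~ z
      u~z = decidable-stable (u ~? z) λ u≁z →
        free (x~u , y~z , x≢y , (λ { refl → x≁z x~u }) , x≁y , u≁z)

  dominating-or-isolated : AlternatingFree → Nonempty S →
    (∃[ v ] v ∈ S × Dominating S v) ⊎ (∃[ v ] v ∈ S × Isolated S v)
  dominating-or-isolated {S} free nonempty
    with any? (λ v → v ∈? S ×-dec all? (λ u → u ∈? S →-dec ¬? (v ~? u)))
  ... | yes (v , v∈S , isolated) = inj₂ (v , v∈S , λ {u} → isolated u)
  ... | no ¬isolated = inj₁ (find-dominating free neighbour nonempty)
    where
    neighbour : ∀ {v} → v ∈ S → ∃[ u ] u ∈ S × v ~ u
    neighbour {v} v∈S = decidable-stable (any? (λ u → u ∈? S ×-dec v ~? u)) λ ¬found →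
      ¬isolated (v , v∈S , λ u u∈S v~u → ¬found (u , u∈S , v~u))

  -- Serves both threshold constructions, which differ in `P` and in the weight given to the deleted
  -- vertex.
  elimination : AlternatingFree → (P : Subset n → Set) →
    (∀ {S} → Empty S → P S) →
    (∀ {S v} → v ∈ S → Dominating S v → P (S - v) → P S) →
    (∀ {S v} → v ∈ S → Isolated S v → P (S - v) → P S) →
    ∀ S → P S
  elimination free P empty dominating isolated S = go S (⊂-wellFounded S)
    where
    go : ∀ S → Acc _⊂_ S → P S
    go S (acc rec) with nonempty? S
    ... | no S-empty = empty S-empty
    ... | yes nonempty with dominating-or-isolated free nonempty
    ...   | inj₁ (v , v∈S , dom) = dominating v∈S dom (go (S - v) (rec (x∈p⇒p-x⊂p v∈S)))
    ...   | inj₂ (v , v∈S , iso) = isolated v∈S iso (go (S - v) (rec (x∈p⇒p-x⊂p v∈S)))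

  -- Threshold weights for the edge hypergraph

  -- Positive weights and a threshold above 1 keep the weight t ∸ 1 of a dominating
  -- vertex positive, and let it reach the threshold with any further vertex.
  EdgeThreshold : Subset n → Set
  EdgeThreshold S = Σ[ w ∈ (Fin n → ℕ) ] Σ[ t ∈ ℕ ]
    (∀ {u} → u ∈ S → 0 < w u) × 1 < t × (∀ X → X ⊆ S → t ≤ weight w X ⇔ HasEdge X)

  edge-threshold-empty : Empty S → EdgeThreshold S
  edge-threshold-empty empty = const 1 , 2 , (λ _ → ≤-refl) , ≤-refl , λ X X⊆S → mk⇔
    (λ 2≤W → let x , x∈X = 0<weight⇒Nonempty (const 1) X (≤-trans (s≤s z≤n) 2≤W)
             in contradiction (x , X⊆S x∈X) empty)
    (λ (u , _ , u∈X , _) → contradiction (u , X⊆S u∈X) empty)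

  edge-threshold-dominating : v ∈ S → Dominating S v → EdgeThreshold (S - v) → EdgeThreshold S
  edge-threshold-dominating {v} {S} v∈S dom (w , suc t , 0<w , s≤s 0<t , thr) =
    w [ v ≔ t ] , suc t , update-positive 0<w 0<t , s≤s 0<t , thr′
    where
    thr′ : ∀ X → X ⊆ S → suc t ≤ weight (w [ v ≔ t ]) X ⇔ HasEdge X
    thr′ X X⊆S with v ∈? X
    ... | no v∉X rewrite weight-update-∉ w v t X v∉X = thr X (p⊆q∧x∉p⇒p⊆q-x X⊆S v∉X)
    -- Both sides now say that `X` has a vertex besides `v`: it is adjacent to `v`, and its positive
    -- weight supplies the missing unit.
    ... | yes v∈X rewrite weight-update-∈ w v t X v∈X = mk⇔ heavy⇒edge edge⇒heavy
      where
      heavy⇒edge : suc t ≤ t + weight w (X - v) → HasEdge X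
      heavy⇒edge t<W with 0<weight⇒Nonempty w (X - v)
        (+-cancelˡ-≤ t 1 _ (≤-trans (≤-reflexive (+-comm t 1)) t<W))
      ... | u , u∈X-v = v , u , v∈X , u∈X , dom (X⊆S u∈X) (x∈p-y⇒x≢y X u∈X-v)
        where
        u∈X = p─q⊆p X ⁅ v ⁆ u∈X-v

      nonempty⇒heavy : Nonempty (X - v) → suc t ≤ t + weight w (X - v)
      nonempty⇒heavy (u , u∈) = ≤-trans (≤-reflexive (+-comm 1 t)) (+-monoʳ-≤ t
        (≤-trans (0<w (p⊆q⇒p-x⊆q-x X⊆S u∈)) (weight-∈-≤ w (X - v) u∈)))

      edge⇒heavy : HasEdge X → suc t ≤ t + weight w (X - v)
      edge⇒heavy (x , y , x∈X , y∈X , x~y) with x ≟ v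
      ... | no x≢v = nonempty⇒heavy (x , x∈p∧x≢y⇒x∈p-y x∈X x≢v)
      ... | yes refl = nonempty⇒heavy (y , x∈p∧x≢y⇒x∈p-y y∈X (≢-sym (~⇒≢ x~y)))

  -- Doubling weights and threshold makes room for a positive weight that decides nothing: the 1 on
  -- `v` cannot lift an even total below `2t` to `2t`.
  edge-threshold-isolated : v ∈ S → Isolated S v → EdgeThreshold (S - v) → EdgeThreshold S
  edge-threshold-isolated {v} {S} v∈S iso (w , t , 0<w , 1<t , thr) =
    2w [ v ≔ 1 ] , t + t ,
    update-positive (λ u∈ → ≤-trans (0<w u∈) (m≤m+n _ _)) ≤-refl ,
    ≤-trans 1<t (m≤m+n t t) , thr′
    where
    2w : Fin n → ℕ
    2w x = w x + w x

    thr′ : ∀ X → X ⊆ S → t + t ≤ weight (2w [ v ≔ 1 ]) X ⇔ HasEdge X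
    thr′ X X⊆S with v ∈? X
    ... | no v∉X rewrite weight-update-∉ 2w v 1 X v∉X | weight-double w X =
      thr X (p⊆q∧x∉p⇒p⊆q-x X⊆S v∉X) ⇔-∘ mk⇔
        (λ 2t≤2W → halve (≤-trans 2t≤2W (n≤1+n _)))
        (λ t≤W → +-mono-≤ t≤W t≤W)
    ... | yes v∈X rewrite weight-update-∈ 2w v 1 X v∈X | weight-double w (X - v) =
      mk⇔ add remove ⇔-∘ (thr (X - v) (p⊆q⇒p-x⊆q-x X⊆S) ⇔-∘ mk⇔
        (halve)
        (λ t≤W → ≤-trans (+-mono-≤ t≤W t≤W) (n≤1+n _)))
      where
      add : HasEdge (X - v) → HasEdge X
      add (x , y , x∈ , y∈ , x~y) = x , y , p─q⊆p X ⁅ v ⁆ x∈ , p─q⊆p X ⁅ v ⁆ y∈ , x~y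

      remove : HasEdge X → HasEdge (X - v)
      remove (x , y , x∈X , y∈X , x~y) = x , y ,
        x∈p∧x≢y⇒x∈p-y x∈X (λ { refl → iso (X⊆S y∈X) x~y }) ,
        x∈p∧x≢y⇒x∈p-y y∈X (λ { refl → iso (X⊆S x∈X) (symmetric x~y) }) , x~y

  AlternatingFree⇒ThresholdGraph : AlternatingFree → ThresholdGraph G
  AlternatingFree⇒ThresholdGraph free
    with elimination free EdgeThreshold edge-threshold-empty edge-threshold-dominating
           edge-threshold-isolated ⊤
  ... | w , t , _ , _ , thr = w , t , λ X → HasEdge⇔Dependent ⇔-∘ thr X ⊆⊤

  -- Threshold weights for the clique hypergraph

  -- For `X` inside `S`, this is dependence in the clique hypergraph of the subgraph induced on `S`.
  CliqueDependent : (S X : Subset n) → Set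
  CliqueDependent S X = ∃[ K ] K ⊆ X × Clique G K × MaximalIn S K

  CliqueThreshold : Subset n → Set
  CliqueThreshold S = Σ[ w ∈ (Fin n → ℕ) ] Σ[ t ∈ ℕ ]
    (∀ X → X ⊆ S → t ≤ weight w X ⇔ CliqueDependent S X)

  -- Without vertices the empty set is a maximal clique, so the only set is dependent and the
  -- threshold is 0.
  clique-threshold-empty : Empty S → CliqueThreshold S
  clique-threshold-empty {S} empty = const 0 , 0 , λ X X⊆S → mk⇔
    (const (whole X X⊆S)) (const z≤n)
    where
    whole : ∀ X → X ⊆ S → CliqueDependent S X
    whole X X⊆S = X , ⊆-refl , (λ u _ u∈X → contradiction (u , X⊆S u∈X) empty) ,
      λ u∈S → contradiction (_ , u∈S) empty

  -- Every maximal clique of `S` contains `v`, and deleting `v` yields the maximal cliques of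
  -- `S - v`. As `k` exceeds `weight w S`, no set without `v` reaches `k + t`.
  clique-threshold-dominating : v ∈ S → Dominating S v → CliqueThreshold (S - v) → CliqueThreshold S
  clique-threshold-dominating {v} {S} v∈S dom (w , t , thr) = w [ v ≔ k ] , k + t , thr′
    where
    k : ℕ
    k = suc (weight w S)

    thr′ : ∀ X → X ⊆ S → k + t ≤ weight (w [ v ≔ k ]) X ⇔ CliqueDependent S X
    thr′ X X⊆S with v ∈? X
    ... | no v∉X rewrite weight-update-∉ w v k X v∉X = mk⇔
      (λ k+t≤W → contradiction
        (≤-trans (m≤m+n k t) (≤-trans k+t≤W (weight-mono-⊆ w X S X⊆S))) (<-irrefl refl))
      (λ (K , K⊆X , _ , max) → contradiction
        (K⊆X (max v∈S λ k∈K k≢v → symmetric (dom (X⊆S (K⊆X k∈K)) k≢v))) v∉X)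
    ... | yes v∈X rewrite weight-update-∈ w v k X v∈X =
      mk⇔ add remove ⇔-∘ (thr (X - v) (p⊆q⇒p-x⊆q-x X⊆S) ⇔-∘
        mk⇔ (+-cancelˡ-≤ k t _) (+-monoʳ-≤ k))
      where
      add : CliqueDependent (S - v) (X - v) → CliqueDependent S X
      add (K , K⊆X-v , clique , max) = K ∪ ⁅ v ⁆ , included ,
        clique-insert clique (λ k∈K k≢v → symmetric (dom (X⊆S (included (p⊆p∪q ⁅ v ⁆ k∈K))) k≢v)) , max′
        where
        included : K ∪ ⁅ v ⁆ ⊆ X
        included x∈ with x∈p∪q⁻ K ⁅ v ⁆ x∈
        ... | inj₁ x∈K = p─q⊆p X ⁅ v ⁆ (K⊆X-v x∈K)
        ... | inj₂ x∈v with refl ← x∈⁅y⁆⇒x≡y v x∈v = v∈X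

        max′ : MaximalIn S (K ∪ ⁅ v ⁆)
        max′ {u} u∈S adj with u ≟ v
        ... | yes refl = q⊆p∪q K ⁅ v ⁆ (x∈⁅x⁆ v)
        ... | no u≢v = p⊆p∪q ⁅ v ⁆ (max (x∈p∧x≢y⇒x∈p-y u∈S u≢v) (adj ∘ p⊆p∪q ⁅ v ⁆))

      remove : CliqueDependent S X → CliqueDependent (S - v) (X - v)
      remove (K , K⊆X , clique , max) = K - v , p⊆q⇒p-x⊆q-x K⊆X ,
        (λ x y x∈ y∈ → clique x y (p─q⊆p K ⁅ v ⁆ x∈) (p─q⊆p K ⁅ v ⁆ y∈)) , max′
        where
        max′ : MaximalIn (S - v) (K - v)
        max′ {u} u∈ adj = x∈p∧x≢y⇒x∈p-y (max u∈S adj′) u≢v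
          where
          u∈S = p─q⊆p S ⁅ v ⁆ u∈
          u≢v = x∈p-y⇒x≢y S u∈

          -- The hypothesis covers only `K - v`; adjacency of `v` and `u` comes from domination.
          adj′ : ∀ {k} → k ∈ K → k ≢ u → k ~ u
          adj′ {k} k∈K k≢u with k ≟ v
          ... | yes refl = dom u∈S u≢v
          ... | no k≢v = adj (x∈p∧x≢y⇒x∈p-y k∈K k≢v) k≢u

  -- If other vertices remain, `v` alone is a maximal clique and lies in no other. It therefore gets
  -- the full weight `t`, and sets without `v` keep their status.
  clique-threshold-isolated : v ∈ S → Isolated S v → CliqueThreshold (S - v) → CliqueThreshold S
  clique-threshold-isolated {v} {S} v∈S iso (w , t , thr) with nonempty? (S - v)
  -- A single vertex is also dominating; treating it as isolated would make ∅ a maximal clique.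
  ... | no single = clique-threshold-dominating v∈S
    (λ u∈S u≢v → contradiction (_ , x∈p∧x≢y⇒x∈p-y u∈S u≢v) single) (w , t , thr)
  ... | yes (s , s∈S-v) = w [ v ≔ t ] , t , thr′
    where
    thr′ : ∀ X → X ⊆ S → t ≤ weight (w [ v ≔ t ]) X ⇔ CliqueDependent S X
    thr′ X X⊆S with v ∈? X
    ... | yes v∈X rewrite weight-update-∈ w v t X v∈X = mk⇔
      (const singleton-dependent) (λ _ → m≤m+n t _)
      where
      v⊆X : ⁅ v ⁆ ⊆ X
      v⊆X x∈ with refl ← x∈⁅y⁆⇒x≡y v x∈ = v∈X

      singleton-clique : Clique G ⁅ v ⁆
      singleton-clique x y x∈ y∈ x≢y =
        contradiction (trans (x∈⁅y⁆⇒x≡y v x∈) (sym (x∈⁅y⁆⇒x≡y v y∈))) x≢y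

      max : MaximalIn S ⁅ v ⁆
      max {u} u∈S adj = decidable-stable (u ∈? ⁅ v ⁆) λ u∉v →
        iso u∈S (adj (x∈⁅x⁆ v) λ { refl → u∉v (x∈⁅x⁆ v) })

      singleton-dependent : CliqueDependent S X
      singleton-dependent = ⁅ v ⁆ , v⊆X , singleton-clique , max
    ... | no v∉X rewrite weight-update-∉ w v t X v∉X =
      mk⇔ add remove ⇔-∘ thr X X⊆S-v
      where
      X⊆S-v = p⊆q∧x∉p⇒p⊆q-x X⊆S v∉X

      remove : CliqueDependent S X → CliqueDependent (S - v) X
      remove (K , K⊆X , clique , max) = K , K⊆X , clique , max ∘ p─q⊆p S ⁅ v ⁆

      add : CliqueDependent (S - v) X → CliqueDependent S X
      add (K , K⊆X , clique , max) = K , K⊆X , clique , max′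
        where
        -- Maximality would put `s` into an empty `K`. A vertex of `K` then prevents the isolated
        -- `v` from extending `K`.
        K-nonempty : Nonempty K
        K-nonempty = decidable-stable (nonempty? K) λ empty →
          empty (s , max s∈S-v λ k∈K → contradiction (_ , k∈K) empty)

        max′ : MaximalIn S K
        max′ {u} u∈S adj with u ≟ v
        ... | no u≢v = max (x∈p∧x≢y⇒x∈p-y u∈S u≢v) adj
        ... | yes refl with K-nonempty
        ...   | k , k∈K = contradiction
          (symmetric (adj k∈K λ { refl → v∉X (K⊆X k∈K) })) (iso (X⊆S (K⊆X k∈K)))

  CliqueDependent-⊤⇔Dependent : CliqueDependent ⊤ X ⇔ Dependent (cliqueHypergraph G) X
  CliqueDependent-⊤⇔Dependent = mk⇔
    (λ (K , K⊆X , clique , max) → K , MaximalIn-⊤⇒MaximalClique clique max , K⊆X)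
    (λ (K , K-max , K⊆X) → K , K⊆X , proj₁ K-max , MaximalClique⇒MaximalIn K-max)

  AlternatingFree⇒Threshold-clique : AlternatingFree → Threshold (cliqueHypergraph G)
  AlternatingFree⇒Threshold-clique free
    with elimination free CliqueThreshold clique-threshold-empty clique-threshold-dominating
           clique-threshold-isolated ⊤
  ... | w , t , thr = w , t , λ X → CliqueDependent-⊤⇔Dependent ⇔-∘ thr X ⊆⊤

-- Assembling the equivalences

theorem20 : ∀ (n : ℕ) (G : Graph n) →
    (ThresholdGraph G ⇔ 1-Sperner (cliqueHypergraph G)) ×
    (1-Sperner (cliqueHypergraph G) ⇔ Threshold (cliqueHypergraph G)) ×
    (Threshold (cliqueHypergraph G) ⇔ 2-Asummable (cliqueHypergraph G))
theorem20 n G =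
  mk⇔ (AlternatingFree⇒1-Sperner G ∘ 2-Asummable-edge⇒AlternatingFree G
         ∘ Threshold⇒2-Asummable (edgeHypergraph G))
      (AlternatingFree⇒ThresholdGraph G ∘ 1-Sperner⇒AlternatingFree G) ,
  mk⇔ (AlternatingFree⇒Threshold-clique G ∘ 1-Sperner⇒AlternatingFree G)
      (AlternatingFree⇒1-Sperner G ∘ 2-Asummable-clique⇒AlternatingFree G
         ∘ Threshold⇒2-Asummable (cliqueHypergraph G)) ,
  mk⇔ (Threshold⇒2-Asummable (cliqueHypergraph G))
      (AlternatingFree⇒Threshold-clique G ∘ 2-Asummable-clique⇒AlternatingFree G)
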